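{- For $n\ge 0$ let \[ a_n:= \sum_{k=0}^n\binom{n}{\lfloor k/2\rfloor}(-2)^{n-k}. \] Then for every integer $n\ge 3$, \[ 2na_n+(5n-4)a_{n-1}-(8n-6)a_{n-2}-20(n-2)a_{n-3}=0. \] -}

module Defs where

open import Data.Fin.Base using (toℕ)
open import Data.Integer.Base using (ℤ; +_; -_; _*_; _^_)
open import Data.Integer.Properties using (+-0-commutativeMonoid)
open import Data.Nat.Base using (ℕ; _∸_; ⌊_/2⌋)
open import Data.Nat.Combinatorics using (_C_)

open import Algebra.Properties.CommutativeMonoid.Sum +-0-commutativeMonoid
  using (sum⁺-syntax)

-- The index i ranges over Fin (suc n), so k = toℕ i runs through 0, …, n and
-- the truncated subtraction n ∸ k is exact.
a : ℕ → ℤ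
a n = ∑[ i ≤ n ] (+ (n C ⌊ toℕ i /2⌋) * (- + 2) ^ (n ∸ toℕ i))

{-# OPTIONS --safe #-}
module Submission where

-- Write m n = C(n, floor(n/2)) for the central binomial coefficient.  The
-- sequence a satisfies an inhomogeneous recurrence of first order,
--
--   2 a (n+1) + 5 a n = 3 m n                                   (a-recurrence)
--
-- and the inhomogeneity satisfies one of second order,
--
--   (n+3) m (n+2) = 2 m (n+1) + 4 (n+1) m n.              (central-recurrence)
--
-- The left-hand side of the theorem at n+3 is the combination of
-- 2 a (k+1) + 5 a k for k = n+2, n+1, n with coefficients n+3, -2, -4(n+1), so
-- it vanishes.
--
-- For a-recurrence, free the upper limit of the sum from n and put
-- S n l = sum over k <= l of C(n, floor(k/2)) (-2)^(l-k), so that a n = S n n.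
-- Then S n (l+1) = -2 S n l + C(n, floor((l+1)/2)) by Horner's rule, and
-- S (n+1) (l+2) = S n (l+2) + S n l by Pascal's rule.  For n >= 1, taking
-- l = n-1 gives a (n+1) = S n (n+1) + S n (n-1), and Horner's rule expresses
-- both terms through a n = S n n, at the cost of C(n, ceil(n/2)) and
-- C(n, floor(n/2)), which are equal.
--
-- For central-recurrence, absorption and symmetry give
-- (floor(n/2) + 1) m (n+1) = (n+1) m n; two instances of this, treated according
-- to the parity of n, yield the claim.

open import Defs
open import Data.Fin.Base using (Fin; toℕ; fromℕ; inject₁)
open import Data.Fin.Properties using (toℕ-fromℕ; toℕ-inject₁; toℕ≤pred[n])
open import Data.Integer.Base using (ℤ; +_; _+_; _-_; _*_; -_; _^_)
open import Data.Integer.Properties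
  using (+-0-commutativeMonoid; +-*-semiring; *-identityʳ; +-inverseʳ; pos-*)
open import Data.Integer.Solver using (module +-*-Solver)
open import Data.Nat.Base as ℕ using (ℕ; zero; suc; _≤_; _∸_; s≤s; z<s; s<s; ⌊_/2⌋; ⌈_/2⌉)
open import Data.Nat.Combinatorics
  using (_C_; nC1≡n; nCk≡nC[n∸k]; nCk+nC[k+1]≡[n+1]C[k+1]; k>n⇒nCk≡0)
import Data.Nat.Properties as ℕ
import Data.Nat.Solver as ℕSolver
open import Data.Sum.Base using (_⊎_; inj₁; inj₂; map)
open import Relation.Binary.PropositionalEquality
  using (_≡_; refl; sym; trans; cong; cong₂; module ≡-Reasoning)

open import Algebra.Properties.CommutativeMonoid.Sum +-0-commutativeMonoid
  using (sum⁺-syntax; sum-init-last; sum-cong-≗)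
open import Algebra.Properties.Semiring.Sum +-*-semiring using (*-distribˡ-sum)

open ≡-Reasoning
open +-*-Solver using (solve; _:=_; _:+_; _:*_; _:-_; :-_; con)
open ℕSolver.+-*-Solver using ()
  renaming (solve to solveℕ; _:=_ to _⊜_; _:+_ to _⊕_; _:*_ to _⊗_; con to conℕ)

-- Binomial coefficients

nC0≡1 : ∀ n → n C 0 ≡ 1
nC0≡1 zero    = refl
nC0≡1 (suc n) = refl

absorption : ∀ n k → suc k ℕ.* (suc n C suc k) ≡ suc n ℕ.* (n C k)
absorption zero    zero    = refl
absorption zero    (suc k) = begin
  suc (suc k) ℕ.* (1 C suc (suc k)) ≡⟨ cong (suc (suc k) ℕ.*_) (k>n⇒nCk≡0 {1} {suc (suc k)} (s<s z<s)) ⟩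
  suc (suc k) ℕ.* 0                 ≡⟨ ℕ.*-zeroʳ (suc (suc k)) ⟩
  0                                 ≡⟨ cong (1 ℕ.*_) (k>n⇒nCk≡0 {0} {suc k} z<s) ⟨
  1 ℕ.* (0 C suc k)                 ∎
absorption (suc n) zero    = begin
  1 ℕ.* (suc (suc n) C 1)           ≡⟨ ℕ.*-identityˡ _ ⟩
  suc (suc n) C 1                   ≡⟨ nC1≡n (suc (suc n)) ⟩
  suc (suc n)                       ≡⟨ ℕ.*-identityʳ _ ⟨
  suc (suc n) ℕ.* 1                 ≡⟨ cong (suc (suc n) ℕ.*_) (nC0≡1 (suc n)) ⟨
  suc (suc n) ℕ.* (suc n C 0)       ∎
absorption (suc n) (suc k) = begin
  suc (suc k) ℕ.* (suc (suc n) C suc (suc k))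
    ≡⟨ cong (suc (suc k) ℕ.*_) (nCk+nC[k+1]≡[n+1]C[k+1] (suc n) (suc k)) ⟨
  suc (suc k) ℕ.* (c ℕ.+ d)
    ≡⟨ solveℕ 3 (λ k c d → (conℕ 2 ⊕ k) ⊗ (c ⊕ d) ⊜
                           c ⊕ ((conℕ 1 ⊕ k) ⊗ c ⊕ (conℕ 2 ⊕ k) ⊗ d)) refl k c d ⟩
  c ℕ.+ (suc k ℕ.* c ℕ.+ suc (suc k) ℕ.* d)
    ≡⟨ cong (c ℕ.+_) (cong₂ ℕ._+_ (absorption n k) (absorption n (suc k))) ⟩
  c ℕ.+ (suc n ℕ.* (n C k) ℕ.+ suc n ℕ.* (n C suc k))
    ≡⟨ cong (c ℕ.+_) (ℕ.*-distribˡ-+ (suc n) (n C k) (n C suc k)) ⟨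
  c ℕ.+ suc n ℕ.* (n C k ℕ.+ n C suc k)
    ≡⟨ cong (λ e → c ℕ.+ suc n ℕ.* e) (nCk+nC[k+1]≡[n+1]C[k+1] n k) ⟩
  suc (suc n) ℕ.* c ∎
  where
  c = suc n C suc k
  d = suc n C suc (suc k)

-- Central binomial coefficients

-- The largest binomial coefficient in row n, taken at the lower of the two
-- middle positions when n is odd.
central : ℕ → ℕ
central n = n C ⌊ n /2⌋

nC⌈n/2⌉≡central : ∀ n → n C ⌈ n /2⌉ ≡ central n
nC⌈n/2⌉≡central n = begin
  n C ⌈ n /2⌉          ≡⟨ nCk≡nC[n∸k] (ℕ.⌈n/2⌉≤n n) ⟩
  n C (n ∸ ⌈ n /2⌉)    ≡⟨ cong (λ l → n C (l ∸ ⌈ n /2⌉)) (ℕ.⌊n/2⌋+⌈n/2⌉≡n n) ⟨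
  n C (⌊ n /2⌋ ℕ.+ ⌈ n /2⌉ ∸ ⌈ n /2⌉) ≡⟨ cong (n C_) (ℕ.m+n∸n≡m ⌊ n /2⌋ ⌈ n /2⌉) ⟩
  central n            ∎

-- Absorption applies in both parities because suc ⌊ n /2⌋ is ⌈ suc n /2⌉.
central-suc : ∀ n → suc ⌊ n /2⌋ ℕ.* central (suc n) ≡ suc n ℕ.* central n
central-suc n = begin
  suc ⌊ n /2⌋ ℕ.* central (suc n)         ≡⟨ cong (suc ⌊ n /2⌋ ℕ.*_) (nC⌈n/2⌉≡central (suc n)) ⟨
  suc ⌊ n /2⌋ ℕ.* (suc n C suc ⌊ n /2⌋)   ≡⟨ absorption n ⌊ n /2⌋ ⟩
  suc n ℕ.* central n                     ∎

⌈n/2⌉≡⌊n/2⌋⊎1+⌊n/2⌋ : ∀ n → ⌈ n /2⌉ ≡ ⌊ n /2⌋ ⊎ ⌈ n /2⌉ ≡ suc ⌊ n /2⌋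
⌈n/2⌉≡⌊n/2⌋⊎1+⌊n/2⌋ zero          = inj₁ refl
⌈n/2⌉≡⌊n/2⌋⊎1+⌊n/2⌋ (suc zero)    = inj₂ refl
⌈n/2⌉≡⌊n/2⌋⊎1+⌊n/2⌋ (suc (suc n)) = map (cong suc) (cong suc) (⌈n/2⌉≡⌊n/2⌋⊎1+⌊n/2⌋ n)

-- To be used with h = ⌊ n /2⌋, h′ = ⌈ n /2⌉, p = central (1 + n) and
-- q = central (2 + n), where the last hypothesis is central-suc (1 + n).  It has
-- to be multiplied by 2 when n is odd, and by 2 + 1 / (h + 1) when n is even,
-- hence the cancellation of h + 1 in that case.
central-step : ∀ h h′ p q → h′ ≡ h ⊎ h′ ≡ suc h →
  suc h′ ℕ.* q ≡ (2 ℕ.+ (h ℕ.+ h′)) ℕ.* p →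
  (3 ℕ.+ (h ℕ.+ h′)) ℕ.* q ≡ (6 ℕ.+ 4 ℕ.* h) ℕ.* p
central-step h .h p q (inj₁ refl) eq = begin
  (3 ℕ.+ (h ℕ.+ h)) ℕ.* q         ≡⟨ cong ((3 ℕ.+ (h ℕ.+ h)) ℕ.*_) q≡2p ⟩
  (3 ℕ.+ (h ℕ.+ h)) ℕ.* (2 ℕ.* p)
    ≡⟨ solveℕ 2 (λ h p → (conℕ 3 ⊕ (h ⊕ h)) ⊗ (conℕ 2 ⊗ p) ⊜
                         (conℕ 6 ⊕ conℕ 4 ⊗ h) ⊗ p) refl h p ⟩
  (6 ℕ.+ 4 ℕ.* h) ℕ.* p           ∎
  where
  q≡2p : q ≡ 2 ℕ.* p
  q≡2p = ℕ.*-cancelˡ-≡ q (2 ℕ.* p) (suc h) (trans eq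
    (solveℕ 2 (λ h p → (conℕ 2 ⊕ (h ⊕ h)) ⊗ p ⊜
                       (conℕ 1 ⊕ h) ⊗ (conℕ 2 ⊗ p)) refl h p))
central-step h .(suc h) p q (inj₂ refl) eq = begin
  (3 ℕ.+ (h ℕ.+ suc h)) ℕ.* q
    ≡⟨ solveℕ 2 (λ h q → (conℕ 3 ⊕ (h ⊕ (conℕ 1 ⊕ h))) ⊗ q ⊜
                         conℕ 2 ⊗ ((conℕ 2 ⊕ h) ⊗ q)) refl h q ⟩
  2 ℕ.* (suc (suc h) ℕ.* q)                 ≡⟨ cong (2 ℕ.*_) eq ⟩
  2 ℕ.* ((2 ℕ.+ (h ℕ.+ suc h)) ℕ.* p)
    ≡⟨ solveℕ 2 (λ h p → conℕ 2 ⊗ ((conℕ 2 ⊕ (h ⊕ (conℕ 1 ⊕ h))) ⊗ p) ⊜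
                         (conℕ 6 ⊕ conℕ 4 ⊗ h) ⊗ p) refl h p ⟩
  (6 ℕ.+ 4 ℕ.* h) ℕ.* p                     ∎

central-recurrence : ∀ n →
  (3 ℕ.+ n) ℕ.* central (2 ℕ.+ n) ≡
  2 ℕ.* central (1 ℕ.+ n) ℕ.+ 4 ℕ.* ((1 ℕ.+ n) ℕ.* central n)
central-recurrence n = begin
  (3 ℕ.+ n) ℕ.* q
    ≡⟨ cong (λ l → (3 ℕ.+ l) ℕ.* q) (ℕ.⌊n/2⌋+⌈n/2⌉≡n n) ⟨
  (3 ℕ.+ (h ℕ.+ h′)) ℕ.* q
    ≡⟨ central-step h h′ p q (⌈n/2⌉≡⌊n/2⌋⊎1+⌊n/2⌋ n)
         (trans (central-suc (suc n))
                (cong (λ l → (2 ℕ.+ l) ℕ.* p) (sym (ℕ.⌊n/2⌋+⌈n/2⌉≡n n)))) ⟩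
  (6 ℕ.+ 4 ℕ.* h) ℕ.* p
    ≡⟨ solveℕ 2 (λ h p → (conℕ 6 ⊕ conℕ 4 ⊗ h) ⊗ p ⊜
                         conℕ 2 ⊗ p ⊕ conℕ 4 ⊗ ((conℕ 1 ⊕ h) ⊗ p)) refl h p ⟩
  2 ℕ.* p ℕ.+ 4 ℕ.* (suc h ℕ.* p)
    ≡⟨ cong (λ l → 2 ℕ.* p ℕ.+ 4 ℕ.* l) (central-suc n) ⟩
  2 ℕ.* p ℕ.+ 4 ℕ.* ((1 ℕ.+ n) ℕ.* central n) ∎
  where
  h  = ⌊ n /2⌋
  h′ = ⌈ n /2⌉
  p  = central (1 ℕ.+ n)
  q  = central (2 ℕ.+ n)

-- The first-order recurrence

horner : ∀ (f : ℕ → ℤ) x l →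
  ∑[ i ≤ suc l ] (f (toℕ i) * x ^ (suc l ∸ toℕ i)) ≡
  x * (∑[ i ≤ l ] (f (toℕ i) * x ^ (l ∸ toℕ i))) + f (suc l)
horner f x l = begin
  ∑[ i ≤ suc l ] t i
    ≡⟨ sum-init-last t ⟩
  ∑[ i ≤ l ] t (inject₁ i) + t (fromℕ (suc l))
    ≡⟨ cong₂ _+_ (sum-cong-≗ init-term) last-term ⟩
  ∑[ i ≤ l ] (x * s i) + f (suc l)
    ≡⟨ cong (_+ f (suc l)) (*-distribˡ-sum x s) ⟨
  x * (∑[ i ≤ l ] s i) + f (suc l) ∎
  where
  t : Fin (suc (suc l)) → ℤ
  t i = f (toℕ i) * x ^ (suc l ∸ toℕ i)

  s : Fin (suc l) → ℤ
  s i = f (toℕ i) * x ^ (l ∸ toℕ i)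

  init-term : ∀ i → t (inject₁ i) ≡ x * s i
  init-term i = begin
    t (inject₁ i)
      ≡⟨ cong (λ k → f k * x ^ (suc l ∸ k)) (toℕ-inject₁ i) ⟩
    f (toℕ i) * x ^ (suc l ∸ toℕ i)
      ≡⟨ cong (λ e → f (toℕ i) * x ^ e) (ℕ.+-∸-assoc 1 (toℕ≤pred[n] i)) ⟩
    f (toℕ i) * (x * x ^ (l ∸ toℕ i))
      ≡⟨ solve 3 (λ c x y → c :* (x :* y) := x :* (c :* y)) refl
           (f (toℕ i)) x (x ^ (l ∸ toℕ i)) ⟩
    x * s i ∎

  last-term : t (fromℕ (suc l)) ≡ f (suc l)
  last-term = begin
    t (fromℕ (suc l))
      ≡⟨ cong (λ k → f k * x ^ (suc l ∸ k)) (toℕ-fromℕ (suc l)) ⟩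
    f (suc l) * x ^ (l ∸ l)
      ≡⟨ cong (λ e → f (suc l) * x ^ e) (ℕ.n∸n≡0 l) ⟩
    f (suc l) * + 1
      ≡⟨ *-identityʳ (f (suc l)) ⟩
    f (suc l) ∎

-- The sum defining a n, with the upper limit of summation (and the exponent)
-- decoupled from the row n: a n is definitionally S n n.
S : ℕ → ℕ → ℤ
S n l = ∑[ i ≤ l ] (+ (n C ⌊ toℕ i /2⌋) * (- + 2) ^ (l ∸ toℕ i))

S-horner : ∀ n l → S n (suc l) ≡ - + 2 * S n l + + (n C ⌊ suc l /2⌋)
S-horner n = horner (λ k → + (n C ⌊ k /2⌋)) (- + 2)

S-0 : ∀ n → S n 0 ≡ + 1
S-0 n = cong (λ c → + c * + 1 + + 0) (nC0≡1 n)

S-1 : ∀ n → S n 1 ≡ - + 1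
S-1 n = trans (S-horner n 0) (cong₂ (λ s c → - + 2 * s + + c) (S-0 n) (nC0≡1 n))

S-pascal : ∀ n l → S (suc n) (2 ℕ.+ l) ≡ S n (2 ℕ.+ l) + S n l
S-pascal n l = begin
  S (suc n) (2 ℕ.+ l)
    ≡⟨ S-horner (suc n) (suc l) ⟩
  - + 2 * S (suc n) (suc l) + + (suc n C suc ⌊ l /2⌋)
    ≡⟨ cong (λ c → - + 2 * S (suc n) (suc l) + + c) (nCk+nC[k+1]≡[n+1]C[k+1] n ⌊ l /2⌋) ⟨
  - + 2 * S (suc n) (suc l) + (+ c₀ + + c₁)
    ≡⟨ step l ⟩
  (- + 2 * S n (suc l) + + c₁) + S n l
    ≡⟨ cong (_+ S n l) (S-horner n (suc l)) ⟨
  S n (2 ℕ.+ l) + S n l ∎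
  where
  c₀ = n C ⌊ l /2⌋
  c₁ = n C suc ⌊ l /2⌋

  -- By Horner's rule, S-pascal at l reduces to S-pascal at l - 1; for l = 0 it
  -- reduces to the independence of S n 1 from n.
  step : ∀ l → - + 2 * S (suc n) (suc l) + (+ (n C ⌊ l /2⌋) + + (n C suc ⌊ l /2⌋)) ≡
               (- + 2 * S n (suc l) + + (n C suc ⌊ l /2⌋)) + S n l
  step zero = begin
    - + 2 * S (suc n) 1 + (+ (n C 0) + + (n C 1))
      ≡⟨ cong₂ (λ s c → - + 2 * s + (+ c + + (n C 1))) (trans (S-1 (suc n)) (sym (S-1 n))) (nC0≡1 n) ⟩
    - + 2 * S n 1 + (+ 1 + + (n C 1))
      ≡⟨ solve 2 (λ s c → con (- + 2) :* s :+ (con (+ 1) :+ c) :=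
                          (con (- + 2) :* s :+ c) :+ con (+ 1)) refl (S n 1) (+ (n C 1)) ⟩
    (- + 2 * S n 1 + + (n C 1)) + + 1
      ≡⟨ cong (λ s → (- + 2 * S n 1 + + (n C 1)) + s) (S-0 n) ⟨
    (- + 2 * S n 1 + + (n C 1)) + S n 0 ∎
  step (suc l) = begin
    - + 2 * S (suc n) (2 ℕ.+ l) + (+ d₀ + + d₁)
      ≡⟨ cong (λ s → - + 2 * s + (+ d₀ + + d₁)) (S-pascal n l) ⟩
    - + 2 * (S n (2 ℕ.+ l) + S n l) + (+ d₀ + + d₁)
      ≡⟨ solve 4 (λ s r c d → con (- + 2) :* (s :+ r) :+ (c :+ d) :=
                              (con (- + 2) :* s :+ d) :+ (con (- + 2) :* r :+ c)) refl
           (S n (2 ℕ.+ l)) (S n l) (+ d₀) (+ d₁) ⟩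
    (- + 2 * S n (2 ℕ.+ l) + + d₁) + (- + 2 * S n l + + d₀)
      ≡⟨ cong (λ s → (- + 2 * S n (2 ℕ.+ l) + + d₁) + s) (S-horner n l) ⟨
    (- + 2 * S n (2 ℕ.+ l) + + d₁) + S n (suc l) ∎
    where
    d₀ = n C ⌊ suc l /2⌋
    d₁ = n C suc ⌊ suc l /2⌋

a-recurrence : ∀ n → + 2 * a (suc n) + + 5 * a n ≡ + 3 * + central n
a-recurrence zero      = refl
a-recurrence n@(suc l) = begin
  + 2 * a (suc n) + + 5 * a n
    ≡⟨ cong (λ s → + 2 * s + + 5 * a n) (S-pascal n l) ⟩
  + 2 * (S n (suc n) + S n l) + + 5 * a n
    ≡⟨ cong (λ s → + 2 * (s + S n l) + + 5 * a n) (S-horner n n) ⟩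
  + 2 * (- + 2 * a n + + (n C ⌈ n /2⌉) + S n l) + + 5 * a n
    ≡⟨ cong₂ (λ c s → + 2 * (- + 2 * a n + + c + S n l) + s)
         (nC⌈n/2⌉≡central n)
         (solve 1 (λ s → con (+ 5) :* s := con (+ 4) :* s :+ s) refl (a n)) ⟩
  + 2 * (- + 2 * a n + m + S n l) + (+ 4 * a n + a n)
    ≡⟨ solve 3 (λ s r c → con (+ 2) :* (con (- + 2) :* s :+ c :+ r) :+ (con (+ 4) :* s :+ s) :=
                          con (+ 2) :* (c :+ r) :+ s) refl (a n) (S n l) m ⟩
  + 2 * (m + S n l) + a n
    ≡⟨ cong (λ s → + 2 * (m + S n l) + s) (S-horner n l) ⟩
  + 2 * (m + S n l) + (- + 2 * S n l + m)
    ≡⟨ solve 2 (λ r c → con (+ 2) :* (c :+ r) :+ (con (- + 2) :* r :+ c) :=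
                        con (+ 3) :* c) refl (S n l) m ⟩
  + 3 * m ∎
  where
  m = + central n

-- The third-order recurrence

central-recurrenceℤ : ∀ n →
  (+ 3 + + n) * + central (2 ℕ.+ n) ≡
  + 2 * + central (1 ℕ.+ n) + + 4 * ((+ 1 + + n) * + central n)
central-recurrenceℤ n = begin
  (+ 3 + + n) * + q                            ≡⟨ pos-* (3 ℕ.+ n) q ⟨
  + ((3 ℕ.+ n) ℕ.* q)                          ≡⟨ cong +_ (central-recurrence n) ⟩
  + (2 ℕ.* p) + + (4 ℕ.* ((1 ℕ.+ n) ℕ.* r))
    ≡⟨ cong₂ _+_ (pos-* 2 p) (trans (pos-* 4 ((1 ℕ.+ n) ℕ.* r)) (cong (+ 4 *_) (pos-* (1 ℕ.+ n) r))) ⟩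
  + 2 * + p + + 4 * ((+ 1 + + n) * + r)        ∎
  where
  q = central (2 ℕ.+ n)
  p = central (1 ℕ.+ n)
  r = central n

-- The elimination of the central coefficients m₀, m₁, m₂ from three consecutive
-- instances of the first-order recurrence; x plays the role of n - 3.
eliminate : ∀ x a₀ a₁ a₂ a₃ m₀ m₁ m₂ →
  + 2 * a₁ + + 5 * a₀ ≡ + 3 * m₀ →
  + 2 * a₂ + + 5 * a₁ ≡ + 3 * m₁ →
  + 2 * a₃ + + 5 * a₂ ≡ + 3 * m₂ →
  (+ 3 + x) * m₂ ≡ + 2 * m₁ + + 4 * ((+ 1 + x) * m₀) →
  + 2 * (+ 3 + x) * a₃
    + (+ 5 * (+ 3 + x) - + 4) * a₂
    - (+ 8 * (+ 3 + x) - + 6) * a₁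
    - + 20 * ((+ 3 + x) - + 2) * a₀
    ≡ + 0
eliminate x a₀ a₁ a₂ a₃ m₀ m₁ m₂ e₀ e₁ e₂ e = begin
  + 2 * (+ 3 + x) * a₃
    + (+ 5 * (+ 3 + x) - + 4) * a₂
    - (+ 8 * (+ 3 + x) - + 6) * a₁
    - + 20 * ((+ 3 + x) - + 2) * a₀
    ≡⟨ solve 5 (λ x a₀ a₁ a₂ a₃ →
         con (+ 2) :* (con (+ 3) :+ x) :* a₃
           :+ (con (+ 5) :* (con (+ 3) :+ x) :- con (+ 4)) :* a₂
           :- (con (+ 8) :* (con (+ 3) :+ x) :- con (+ 6)) :* a₁
           :- con (+ 20) :* ((con (+ 3) :+ x) :- con (+ 2)) :* a₀
         := (con (+ 3) :+ x) :* (con (+ 2) :* a₃ :+ con (+ 5) :* a₂)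
           :- (con (+ 2) :* (con (+ 2) :* a₂ :+ con (+ 5) :* a₁)
             :+ con (+ 4) :* ((con (+ 1) :+ x) :* (con (+ 2) :* a₁ :+ con (+ 5) :* a₀))))
         refl x a₀ a₁ a₂ a₃ ⟩
  (+ 3 + x) * (+ 2 * a₃ + + 5 * a₂)
    - (+ 2 * (+ 2 * a₂ + + 5 * a₁) + + 4 * ((+ 1 + x) * (+ 2 * a₁ + + 5 * a₀)))
    ≡⟨ cong₂ (λ u v → (+ 3 + x) * u - v) e₂
         (cong₂ (λ v w → + 2 * v + + 4 * ((+ 1 + x) * w)) e₁ e₀) ⟩
  (+ 3 + x) * (+ 3 * m₂) - (+ 2 * (+ 3 * m₁) + + 4 * ((+ 1 + x) * (+ 3 * m₀)))
    ≡⟨ solve 4 (λ x m₀ m₁ m₂ →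
         (con (+ 3) :+ x) :* (con (+ 3) :* m₂)
           :- (con (+ 2) :* (con (+ 3) :* m₁)
             :+ con (+ 4) :* ((con (+ 1) :+ x) :* (con (+ 3) :* m₀)))
         := con (+ 3) :* ((con (+ 3) :+ x) :* m₂)
           :- con (+ 3) :* (con (+ 2) :* m₁ :+ con (+ 4) :* ((con (+ 1) :+ x) :* m₀)))
         refl x m₀ m₁ m₂ ⟩
  + 3 * ((+ 3 + x) * m₂) - + 3 * r
    ≡⟨ cong (λ l → + 3 * l - + 3 * r) e ⟩
  + 3 * r - + 3 * r
    ≡⟨ +-inverseʳ (+ 3 * r) ⟩
  + 0 ∎
  where
  r = + 2 * m₁ + + 4 * ((+ 1 + x) * m₀)

theorem7p1 : (n : ℕ) → 3 ≤ n →
    + 2 * + n * a n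
    + (+ 5 * + n - + 4) * a (n ∸ 1)
    - (+ 8 * + n - + 6) * a (n ∸ 2)
    - + 20 * (+ n - + 2) * a (n ∸ 3)
    ≡ + 0
theorem7p1 (suc (suc (suc n))) (s≤s (s≤s (s≤s _))) =
  eliminate (+ n) (a n) (a (1 ℕ.+ n)) (a (2 ℕ.+ n)) (a (3 ℕ.+ n))
    (+ central n) (+ central (1 ℕ.+ n)) (+ central (2 ℕ.+ n))
    (a-recurrence n) (a-recurrence (1 ℕ.+ n)) (a-recurrence (2 ℕ.+ n))
    (central-recurrenceℤ n)
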